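{- $\mathsf{KD45}_{B}$ is a sound and complete axiomatization of $\mathcal{L}_B$ with respect to the class of all topological subset spaces: for every $\varphi\in\mathcal{L}_B$, $\varphi$ is provable in $\mathsf{KD45}_{B}$ if and only if $\varphi$ is valid in all topological subset models.
   Context: Language. Fix a countable set PROP of primitive propositions. $\mathcal{L}_B$ is generated by $\varphi ::= p \mid \neg\varphi \mid \varphi\wedge\psi \mid B\varphi$, $p\in$ PROP, with $\vee,\to,\leftrightarrow$ defined as usual. The logic $\mathsf{KD45}_B$ (over $\mathcal{L}_B$) consists of classical propositional logic (with modus ponens), the schemes $B(\varphi\to\psi)\to(B\varphi\to B\psi)$, $B\varphi\to\neg B\neg\varphi$, $B\varphi\to BB\varphi$, $\neg B\varphi\to B\neg B\varphi$, and the rule "from $\vdash\varphi$ infer $\vdash B\varphi$". Semantics. A topological subset model is a triple $\mathcal{X}=(X,\mathcal{T},v)$ where $X$ is a nonempty set, $\mathcal{T}$ is a topology on $X$, and $v:\mathrm{PROP}\to 2^X$. An epistemic scenario of $\mathcal X$ is a pair $(x,U)$ with $x\in U\in\mathcal{T}$. Let $\mathit{int}$ and $\mathit{cl}$ denote interior and closure in $(X,\mathcal{T})$, and let $[\![\varphi]\!]^{U}=\{y\in U : (\mathcal{X},y,U)\models\varphi\}$. Truth at an epistemic scenario is defined by: $(\mathcal{X},x,U)\models p$ iff $x\in v(p)$; $(\mathcal{X},x,U)\models\neg\varphi$ iff $(\mathcal{X},x,U)\not\models\varphi$; $(\mathcal{X},x,U)\models\varphi\wedge\psi$ iff $(\mathcal{X},x,U)\models\varphi$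 and $(\mathcal{X},x,U)\models\psi$; $(\mathcal{X},x,U)\models B\varphi$ iff $U\subseteq\mathit{cl}(\mathit{int}([\![\varphi]\!]^{U}))$. A formula is valid in $\mathcal{X}$ if it is true at every epistemic scenario of $\mathcal X$. -}

module Defs where

open import Data.Bool.Base using (Bool; true; not) renaming (_∧_ to _and_)
open import Data.Product.Base using (Σ-syntax; _×_)
open import Level using (Level; suc; Lift)
open import Relation.Binary.PropositionalEquality.Core using (_≡_)
open import Relation.Nullary.Negation.Core using (¬_)
open import Relation.Unary using (Pred; _∈_; _⊆_; _≐_; _∩_; ∁; ⋃)
open import Relation.Unary.Polymorphic using (∅; U)

infix  8 ∼_ B_
infixr 7 _∧_
infixr 6 _⇒_

data Formula (PROP : Set) : Set where
  atom : PROP → Formula PROP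
  ∼_   : Formula PROP → Formula PROP
  _∧_  : Formula PROP → Formula PROP → Formula PROP
  B_   : Formula PROP → Formula PROP

_⇒_ : ∀ {PROP} → Formula PROP → Formula PROP → Formula PROP
φ ⇒ ψ = ∼ (φ ∧ ∼ ψ)

-- Truth-table evaluation in which formulas of the form p and B φ are both
-- treated as propositional units, with truth values assigned by p̂ and β.
eval : ∀ {PROP} → (PROP → Bool) → (Formula PROP → Bool) → Formula PROP → Bool
eval p̂ β (atom p) = p̂ p
eval p̂ β (∼ φ)    = not (eval p̂ β φ)
eval p̂ β (φ ∧ ψ)  = eval p̂ β φ and eval p̂ β ψ
eval p̂ β (B φ)    = β φ

-- Substitution instances, in the full language, of classical tautologies.
Tautology : ∀ {PROP} → Formula PROP → Set
Tautology φ = ∀ p̂ β → eval p̂ β φ ≡ true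

infix 4 KD45⊢_

data KD45⊢_ {PROP : Set} : Formula PROP → Set where
  taut  : ∀ {φ} → Tautology φ → KD45⊢ φ
  K     : ∀ φ ψ → KD45⊢ B (φ ⇒ ψ) ⇒ (B φ ⇒ B ψ)
  D     : ∀ φ → KD45⊢ B φ ⇒ ∼ (B (∼ φ))
  four  : ∀ φ → KD45⊢ B φ ⇒ B (B φ)
  five  : ∀ φ → KD45⊢ ∼ (B φ) ⇒ B (∼ (B φ))
  mp    : ∀ {φ ψ} → KD45⊢ φ ⇒ ψ → KD45⊢ φ → KD45⊢ ψ
  nec   : ∀ {φ} → KD45⊢ φ → KD45⊢ B φ

-- Subsets of X are predicates, so openness has to be stable under extensional
-- equality of predicates. For families of opens, an index type in Set ℓ is
-- no restriction in the presence of excluded middle: Pred X ℓ is then, up to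
-- _≐_, the same as X → Bool, which lives in Set ℓ.
record Topology {ℓ : Level} (X : Set ℓ) : Set (suc (suc ℓ)) where
  field
    Open      : Pred (Pred X ℓ) (suc ℓ)
    Open-resp : ∀ {V W} → V ≐ W → Open V → Open W
    Open-∅    : Open ∅
    Open-U    : Open U
    Open-∩    : ∀ {V W} → Open V → Open W → Open (V ∩ W)
    Open-⋃    : (I : Set ℓ) (F : I → Pred X ℓ) → (∀ i → Open (F i)) → Open (⋃ I F)

  Closed : Pred (Pred X ℓ) (suc ℓ)
  Closed C = Open (∁ C)

  int : ∀ {a} → Pred X a → Pred X _
  int A x = Σ[ V ∈ Pred X ℓ ] Open V × V ⊆ A × x ∈ V

  cl : ∀ {a} → Pred X a → Pred X _
  cl A x = (C : Pred X ℓ) → Closed C → A ⊆ C → x ∈ C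

record TopSubsetModel (PROP : Set) (ℓ : Level) : Set (suc (suc ℓ)) where
  field
    X        : Set ℓ
    nonempty : X
    topology : Topology X
    v        : PROP → Pred X ℓ

  open Topology topology public

module _ {PROP : Set} {ℓ : Level} (𝒳 : TopSubsetModel PROP ℓ) where
  open TopSubsetModel 𝒳

  -- The clauses make sense for any pair (x , V). Only epistemic scenarios,
  -- x ∈ V with V open, matter: Valid is restricted to them, and the clause for
  -- B evaluates its argument only at points of the same V.
  mutual
    Truth : X → Pred X ℓ → Formula PROP → Set (suc ℓ)
    Truth x V (atom p) = Lift (suc ℓ) (x ∈ v p)
    Truth x V (∼ φ)    = ¬ Truth x V φ
    Truth x V (φ ∧ ψ)  = Truth x V φ × Truth x V ψ
    Truth x V (B φ)    = V ⊆ cl (int (⟦ φ ⟧ V))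

    ⟦_⟧ : Formula PROP → Pred X ℓ → Pred X (suc ℓ)
    ⟦ φ ⟧ V y = y ∈ V × Truth y V φ

  Valid : Formula PROP → Set (suc ℓ)
  Valid φ = ∀ x V → x ∈ V → Open V → Truth x V φ

{-# OPTIONS --safe #-}

-- Soundness: for V open, V ⊆ cl (int ⟦ φ ⟧) says that ⟦ φ ⟧ contains an open
-- set dense in V; finitely many dense open sets have dense, hence for V ≠ ∅
-- inhabited, intersection, and the truth of B φ depends on V only.
--
-- Completeness: extend an unprovable formula's negation to a consistent formula
-- γ deciding a finite closure. A single formula θ with γ ⊢ B θ collects what γ
-- believes in the closure. The consistent formulas that decide the closure and
-- prove θ form a cluster W; add γ as one further point and let ∅, W and the
-- whole space be the open sets. A set then has dense interior iff it contains
-- W, so that B quantifies over W and the truth lemma holds on the whole space.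
module Submission where

open import Defs
open import Axiom.ExcludedMiddle using (ExcludedMiddle)
open import Data.Bool.Base using (Bool; true; false; not; T) renaming (_∧_ to _and_)
open import Data.Bool.Properties using (T-∧; T-≡)
open import Data.Empty using (⊥; ⊥-elim)
open import Data.Fin.Base using (Fin; zero)
open import Data.List.Base using (List; []; _∷_; _++_)
open import Data.List.Membership.Propositional using () renaming (_∈_ to _∈ₗ_)
open import Data.List.Relation.Binary.Subset.Propositional using () renaming (_⊆_ to _⊆ₗ_)
open import Data.List.Relation.Binary.Subset.Propositional.Properties using (xs⊆xs++ys; xs⊆ys++xs)
open import Data.List.Relation.Unary.All as All using (All; []; _∷_)
open import Data.List.Relation.Unary.Any using (here; there)
open import Data.Maybe.Base using (Maybe; just; nothing; maybe)
open import Data.Nat.Base using (ℕ; zero)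
open import Data.Product.Base using (∃-syntax; _×_; _,_; proj₁; proj₂)
open import Data.Sum.Base using (_⊎_; inj₁; inj₂; [_,_]′)
open import Data.Unit.Base using (⊤; tt)
open import Data.Vec.Base as Vec using (Vec; []; _∷_; lookup)
open import Data.Vec.Properties using (lookup-map)
open import Function.Base using (_∘_)
open import Function.Bundles using (_↣_; _⇔_; mk⇔; Equivalence)
open import Level using (Level; 0ℓ; suc; Lift; lift; lower)
open import Relation.Binary.PropositionalEquality using (_≡_; refl; sym; trans; cong; cong₂; subst)
open import Relation.Nullary.Decidable using (Dec; yes; no; does; proof; map′; decidable-stable)
open import Relation.Nullary.Negation using (¬_; contradiction)
open import Relation.Nullary.Reflects using (Reflects; invert; ¬-reflects; _×-reflects_)
open import Relation.Unary using (Pred; _∈_; _⊆_; _∩_; ∁)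
open import Relation.Unary.Polymorphic using (U; ∅)

private
  variable
    PROP : Set
    α β γ φ ψ : Formula PROP

-- Tautologies from finite truth tables

everywhere : ∀ n → (Vec Bool n → Bool) → Bool
everywhere zero    f = f []
everywhere (ℕ.suc n) f = everywhere n (f ∘ (true ∷_)) and everywhere n (f ∘ (false ∷_))

everywhere-sound : ∀ n f → T (everywhere n f) → ∀ v → f v ≡ true
everywhere-sound zero    f t []          = Equivalence.to T-≡ t
everywhere-sound (ℕ.suc n) f t (true ∷ v)  = everywhere-sound n _ (proj₁ (Equivalence.to T-∧ t)) v
everywhere-sound (ℕ.suc n) f t (false ∷ v) = everywhere-sound n _ (proj₂ (Equivalence.to T-∧ t)) v

instantiate : ∀ {n} → Vec (Formula PROP) n → Formula (Fin n) → Formula PROP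
instantiate σ (atom i) = lookup σ i
instantiate σ (∼ s)    = ∼ instantiate σ s
instantiate σ (s ∧ t)  = instantiate σ s ∧ instantiate σ t
instantiate σ (B s)    = B instantiate σ s

eval-instantiate : ∀ {n} (σ : Vec (Formula PROP) n) p̂ b s →
  eval p̂ b (instantiate σ s) ≡ eval (lookup (Vec.map (eval p̂ b) σ)) (b ∘ instantiate σ) s
eval-instantiate σ p̂ b (atom i) = sym (lookup-map i (eval p̂ b) σ)
eval-instantiate σ p̂ b (∼ s)    = cong not (eval-instantiate σ p̂ b s)
eval-instantiate σ p̂ b (s ∧ t)  = cong₂ _and_ (eval-instantiate σ p̂ b s) (eval-instantiate σ p̂ b t)
eval-instantiate σ p̂ b (B s)    = refl

-- For a schema s without B the truth table does not depend on b, and the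
-- condition computes to ⊤.
schema : ∀ {n} (s : Formula (Fin n)) →
  (∀ b → T (everywhere n (λ v → eval (lookup v) b s))) →
  (σ : Vec (Formula PROP) n) → KD45⊢ instantiate σ s
schema s t σ = taut λ p̂ b →
  trans (eval-instantiate σ p̂ b s) (everywhere-sound _ _ (t _) (Vec.map (eval p̂ b) σ))

private
  a₀ : ∀ {n} → Formula (Fin (ℕ.suc n))
  a₀ = atom zero
  a₁ : ∀ {n} → Formula (Fin (ℕ.suc (ℕ.suc n)))
  a₁ = atom (Fin.suc zero)
  a₂ : ∀ {n} → Formula (Fin (ℕ.suc (ℕ.suc (ℕ.suc n))))
  a₂ = atom (Fin.suc (Fin.suc zero))

-- Derived propositional and modal rules

⇒-refl : KD45⊢ α ⇒ α
⇒-refl {α = α} = schema (a₀ ⇒ a₀) _ (α ∷ [])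

⇒-const : KD45⊢ β → KD45⊢ α ⇒ β
⇒-const {β = β} {α = α} = mp (schema (a₁ ⇒ (a₀ ⇒ a₁)) _ (α ∷ β ∷ []))

⇒-trans : KD45⊢ α ⇒ β → KD45⊢ β ⇒ γ → KD45⊢ α ⇒ γ
⇒-trans {α = α} {β = β} {γ = γ} p q =
  mp (mp (schema ((a₀ ⇒ a₁) ⇒ ((a₁ ⇒ a₂) ⇒ (a₀ ⇒ a₂))) _ (α ∷ β ∷ γ ∷ [])) p) q

⇒-ap : KD45⊢ α ⇒ (β ⇒ γ) → KD45⊢ α ⇒ β → KD45⊢ α ⇒ γ
⇒-ap {α = α} {β = β} {γ = γ} p q =
  mp (mp (schema ((a₀ ⇒ (a₁ ⇒ a₂)) ⇒ ((a₀ ⇒ a₁) ⇒ (a₀ ⇒ a₂))) _ (α ∷ β ∷ γ ∷ [])) p) q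

∧-pair : KD45⊢ α ⇒ (β ⇒ α ∧ β)
∧-pair {α = α} {β = β} = schema (a₀ ⇒ (a₁ ⇒ a₀ ∧ a₁)) _ (α ∷ β ∷ [])

∧-intro : KD45⊢ α ⇒ β → KD45⊢ α ⇒ γ → KD45⊢ α ⇒ β ∧ γ
∧-intro p q = ⇒-ap (⇒-trans p ∧-pair) q

∧-elimˡ : KD45⊢ α ∧ β ⇒ α
∧-elimˡ {α = α} {β = β} = schema (a₀ ∧ a₁ ⇒ a₀) _ (α ∷ β ∷ [])

∧-elimʳ : KD45⊢ α ∧ β ⇒ β
∧-elimʳ {α = α} {β = β} = schema (a₀ ∧ a₁ ⇒ a₁) _ (α ∷ β ∷ [])

∼∧ˡ : KD45⊢ ∼ α ⇒ ∼ (α ∧ β)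
∼∧ˡ {α = α} {β = β} = schema (∼ a₀ ⇒ ∼ (a₀ ∧ a₁)) _ (α ∷ β ∷ [])

∼∧ʳ : KD45⊢ ∼ β ⇒ ∼ (α ∧ β)
∼∧ʳ {β = β} {α = α} = schema (∼ a₁ ⇒ ∼ (a₀ ∧ a₁)) _ (α ∷ β ∷ [])

∼∼-intro : KD45⊢ α ⇒ ∼ ∼ α
∼∼-intro {α = α} = schema (a₀ ⇒ ∼ ∼ a₀) _ (α ∷ [])

∼∼-elim : KD45⊢ ∼ ∼ α ⇒ α
∼∼-elim {α = α} = schema (∼ ∼ a₀ ⇒ a₀) _ (α ∷ [])

⇒-absurd : KD45⊢ α ⇒ β → KD45⊢ α ⇒ ∼ β → KD45⊢ ∼ α
⇒-absurd {α = α} {β = β} p q =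
  mp (mp (schema ((a₀ ⇒ a₁) ⇒ ((a₀ ⇒ ∼ a₁) ⇒ ∼ a₀)) _ (α ∷ β ∷ [])) p) q

∼-cases : KD45⊢ ∼ (α ∧ β) → KD45⊢ ∼ (α ∧ ∼ β) → KD45⊢ ∼ α
∼-cases {α = α} {β = β} p q =
  mp (mp (schema (∼ (a₀ ∧ a₁) ⇒ (∼ (a₀ ∧ ∼ a₁) ⇒ ∼ a₀)) _ (α ∷ β ∷ [])) p) q

B-mono : KD45⊢ α ⇒ β → KD45⊢ B α ⇒ B β
B-mono p = mp (K _ _) (nec p)

B-∧ : KD45⊢ γ ⇒ B α → KD45⊢ γ ⇒ B β → KD45⊢ γ ⇒ B (α ∧ β)
B-∧ p q = ⇒-ap (⇒-trans p (⇒-trans (B-mono ∧-pair) (K _ _))) q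

-- Consistency and finite Lindenbaum extension

Consistent : Formula PROP → Set
Consistent γ = ¬ (KD45⊢ ∼ γ)

Decides : Formula PROP → Formula PROP → Set
Decides γ χ = (KD45⊢ γ ⇒ χ) ⊎ (KD45⊢ γ ⇒ ∼ χ)

-- ∼ (B φ) belongs to the closure so that, by axiom five, γ's disbeliefs are
-- among the beliefs collected in θ.
closure : Formula PROP → List (Formula PROP)
closure (atom p) = atom p ∷ []
closure (∼ φ)    = closure φ
closure (φ ∧ ψ)  = closure φ ++ closure ψ
closure (B φ)    = B φ ∷ ∼ (B φ) ∷ φ ∷ closure φ

module Lindenbaum (em₀ : ∀ {P : Set} → Dec P) {PROP : Set} where

  extend : (L : List (Formula PROP)) → ∀ γ → Consistent γ →
    ∃[ δ ] Consistent δ × (KD45⊢ δ ⇒ γ) × All (Decides δ) L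
  extend []      γ con = γ , con , ⇒-refl , []
  extend (χ ∷ L) γ con with extend L γ con
  ... | δ , con′ , δ⇒γ , dec with em₀ {KD45⊢ ∼ (δ ∧ χ)}
  ... | no ok   = δ ∧ χ , ok , ⇒-trans ∧-elimˡ δ⇒γ ,
                  inj₁ ∧-elimʳ ∷ All.map [ inj₁ ∘ ⇒-trans ∧-elimˡ , inj₂ ∘ ⇒-trans ∧-elimˡ ]′ dec
  -- If `δ` were inconsistent with `∼ χ` as well, `∼-cases` would refute `δ` itself.
  ... | yes bad = δ ∧ ∼ χ , con′ ∘ ∼-cases bad , ⇒-trans ∧-elimˡ δ⇒γ ,
                  inj₂ ∧-elimʳ ∷ All.map [ inj₁ ∘ ⇒-trans ∧-elimˡ , inj₂ ∘ ⇒-trans ∧-elimˡ ]′ dec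

  -- `θ` is the conjunction of the believed members of `L`, with the tautology `γ ⇒ γ` as empty
  -- conjunction.
  beliefs : (L : List (Formula PROP)) → ∀ γ →
    ∃[ θ ] (KD45⊢ γ ⇒ B θ) × All (λ χ → KD45⊢ γ ⇒ B χ → KD45⊢ θ ⇒ χ) L
  beliefs []      γ = γ ⇒ γ , ⇒-const (nec ⇒-refl) , []
  beliefs (χ ∷ L) γ with beliefs L γ | em₀ {KD45⊢ γ ⇒ B χ}
  ... | θ , γ⇒Bθ , θ⇒L | yes γ⇒Bχ =
    χ ∧ θ , B-∧ γ⇒Bχ γ⇒Bθ ,
    (λ _ → ∧-elimˡ) ∷ All.map (λ f q → ⇒-trans ∧-elimʳ (f q)) θ⇒L
  ... | θ , γ⇒Bθ , θ⇒L | no γ⇏Bχ = θ , γ⇒Bθ , (λ q → contradiction q γ⇏Bχ) ∷ θ⇒L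

-- The space of a cluster and one further point

module ClusterModel {ℓ : Level} (em : ExcludedMiddle (suc ℓ)) {PROP : Set}
  (W : Set) (w₀ : W) (val : PROP → Pred (Maybe W) 0ℓ) where

  model : TopSubsetModel PROP ℓ
  model = record
    { X        = Lift ℓ (Maybe W)
    ; nonempty = lift nothing
    ; topology = record
      -- An inhabited `V` must contain every `just w`; only membership of `nothing` is left free.
      { Open      = λ V → Lift (suc ℓ) (∀ x w → x ∈ V → lift (just w) ∈ V)
      ; Open-resp = λ (V⊆ , ⊆V) o → lift λ x w x∈ → V⊆ (lower o x w (⊆V x∈))
      ; Open-∅    = lift λ _ _ ()
      ; Open-U    = lift _
      ; Open-∩    = λ o o′ → lift λ x w (p , q) → lower o x w p , lower o′ x w q
      ; Open-⋃    = λ I F o → lift λ x w (i , p) → i , lower (o i) x w p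
      }
    ; v        = λ p x → Lift ℓ (val p (lower x))
    }

  open TopSubsetModel model

  True : Maybe W → Formula PROP → Set (suc ℓ)
  True x = Truth model (lift x) U

  -- If `φ` failed at `just w`, no inhabited open set would fit inside its truth set, so the closed
  -- set `∅` would contain the interior.
  True-B⁻ : ∀ {x} → True x (B φ) → ∀ w → True (just w) φ
  True-B⁻ {x = x} b w = decidable-stable em λ f →
    lower (b {lift x} _ ∅ (lift λ _ _ _ ()) (λ (V , o , V⊆ , y∈V) → ⊥-elim (f (proj₂ (V⊆ (lower o _ w y∈V))))))

  -- The interior contains the cluster, hence `w₀`. A point outside the closed `C` would make `∁ C`
  -- inhabited and open, so `w₀` would lie outside `C`.
  True-B⁺ : ∀ {x} → (∀ w → True (just w) φ) → True x (B φ)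
  True-B⁺ all {y} _ C closed ⊆C =
    lower (decidable-stable em λ f → lower closed y w₀ (f ∘ lift) (⊆C w₀∈int))
    where
    Cluster : Pred X ℓ
    Cluster (lift x) = Lift ℓ (maybe (λ _ → ⊤) ⊥ x)

    w₀∈int = Cluster , lift _ , (λ { {lift (just w)} _ → _ , all w }) , lift tt

-- Canonical worlds and the truth lemma

module Canonical {ℓ : Level} (em : ExcludedMiddle (suc ℓ)) {PROP : Set}
  (L : List (Formula PROP)) (γ : Formula PROP) (γ-con : Consistent γ)
  (γ-dec : All (Decides γ) L)
  (θ : Formula PROP) (γ⇒Bθ : KD45⊢ γ ⇒ B θ)
  (θ⇒ : All (λ χ → KD45⊢ γ ⇒ B χ → KD45⊢ θ ⇒ χ) L) where

  open Lindenbaum (map′ lower lift em)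

  record World : Set where
    constructor world
    field
      form       : Formula PROP
      consistent : Consistent form
      form⇒θ     : KD45⊢ form ⇒ θ
      decides    : All (Decides form) L

  open World

  toWorld : Consistent (θ ∧ ψ) → ∃[ w ] (KD45⊢ form w ⇒ ψ)
  toWorld con with extend L _ con
  ... | δ , con′ , δ⇒ , dec = world δ con′ (⇒-trans δ⇒ ∧-elimˡ) dec , ⇒-trans δ⇒ ∧-elimʳ

  -- By definition `θ ⇒ ψ` is `∼ (θ ∧ ∼ ψ)`, so a refutation of `θ ∧ ∼ ψ` would turn `γ ⇒ B θ` into
  -- `γ ⇒ B ψ`.
  refuting : ¬ (KD45⊢ γ ⇒ B ψ) → ∃[ w ] (KD45⊢ form w ⇒ ∼ ψ)
  refuting γ⇏Bψ = toWorld λ θ⇒ψ → γ⇏Bψ (⇒-trans γ⇒Bθ (B-mono θ⇒ψ))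

  w₀ : World
  -- Axiom `D` makes the cluster inhabited: `γ` believes `θ`, so it cannot believe `∼ θ`.
  w₀ = proj₁ (refuting {∼ θ} λ γ⇒B∼θ → γ-con (⇒-absurd γ⇒B∼θ (⇒-trans γ⇒Bθ (D θ))))

  formula : Maybe World → Formula PROP
  formula = maybe form γ

  formula-consistent : ∀ x → Consistent (formula x)
  formula-consistent (just w) = consistent w
  formula-consistent nothing  = γ-con

  formula-decides : ∀ x → All (Decides (formula x)) L
  formula-decides (just w) = decides w
  formula-decides nothing  = γ-dec

  -- If `χ` implies its own belief, then `γ` believes `χ`, so `θ` and with it every world proves
  -- `χ`.
  formula-introspects : ∀ x {χ} → KD45⊢ χ ⇒ B χ → χ ∈ₗ L → KD45⊢ γ ⇒ χ → KD45⊢ formula x ⇒ χ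
  formula-introspects (just w) χ⇒Bχ χ∈ γ⇒χ =
    ⇒-trans (form⇒θ w) (All.lookup θ⇒ χ∈ (⇒-trans γ⇒χ χ⇒Bχ))
  formula-introspects nothing _ _ γ⇒χ = γ⇒χ

  open ClusterModel {ℓ} em World w₀ (λ p x → KD45⊢ formula x ⇒ atom p) public

  clash : ∀ x → KD45⊢ formula x ⇒ ψ → KD45⊢ formula x ⇒ ∼ ψ → ⊥
  clash x p q = formula-consistent x (⇒-absurd p q)

  Settled : Maybe World → Formula PROP → Set _
  Settled x ψ = (True x ψ × (KD45⊢ formula x ⇒ ψ)) ⊎ (¬ True x ψ × (KD45⊢ formula x ⇒ ∼ ψ))

  settled : ∀ x ψ → closure ψ ⊆ₗ L → Settled x ψ
  settled x (atom p) ⊆L with All.lookup (formula-decides x) (⊆L (here refl))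
  ... | inj₁ ⇒p  = inj₁ (lift (lift ⇒p) , ⇒p)
  ... | inj₂ ⇒∼p = inj₂ ((λ t → clash x (lower (lower t)) ⇒∼p) , ⇒∼p)
  settled x (∼ ψ) ⊆L with settled x ψ ⊆L
  ... | inj₁ (t , ⇒ψ)  = inj₂ ((λ f → f t) , ⇒-trans ⇒ψ ∼∼-intro)
  ... | inj₂ (f , ⇒∼ψ) = inj₁ (f , ⇒∼ψ)
  settled x (ψ ∧ χ) ⊆L with settled x ψ (⊆L ∘ xs⊆xs++ys _ _) | settled x χ (⊆L ∘ xs⊆ys++xs _ (closure ψ))
  ... | inj₁ (t , ⇒ψ)  | inj₁ (t′ , ⇒χ)  = inj₁ ((t , t′) , ∧-intro ⇒ψ ⇒χ)
  ... | inj₂ (f , ⇒∼ψ) | _               = inj₂ (f ∘ proj₁ , ⇒-trans ⇒∼ψ ∼∧ˡ)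
  ... | _              | inj₂ (f , ⇒∼χ)  = inj₂ (f ∘ proj₂ , ⇒-trans ⇒∼χ ∼∧ʳ)
  -- The case split is on `γ` whatever `x` is, since the truth of `B ψ` is the same at all points.
  settled x (B ψ) ⊆L with All.lookup γ-dec (⊆L (here refl))
  ... | inj₁ γ⇒Bψ = inj₁ (True-B⁺ {ψ} {x} believed , formula-introspects x (four ψ) (⊆L (here refl)) γ⇒Bψ)
    where
    believed : ∀ w → True (just w) ψ
    believed w with settled (just w) ψ (⊆L ∘ there ∘ there ∘ there)
    ... | inj₁ (t , _)   = t
    ... | inj₂ (_ , ⇒∼ψ) =
      ⊥-elim (clash (just w) (⇒-trans (form⇒θ w) (All.lookup θ⇒ (⊆L (there (there (here refl)))) γ⇒Bψ)) ⇒∼ψ)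
  ... | inj₂ γ⇒∼Bψ = inj₂ (disbelieved , formula-introspects x (five ψ) (⊆L (there (here refl))) γ⇒∼Bψ)
    where
    disbelieved : ¬ True x (B ψ)
    disbelieved b with refuting {ψ} (λ γ⇒Bψ → clash nothing γ⇒Bψ γ⇒∼Bψ)
    ... | w , w⇒∼ψ with settled (just w) ψ (⊆L ∘ there ∘ there ∘ there)
    ... | inj₁ (_ , w⇒ψ) = clash (just w) w⇒ψ w⇒∼ψ
    ... | inj₂ (f , _)   = f (True-B⁻ {ψ} {x} b w)

-- Soundness in arbitrary spaces

module Soundness {ℓ : Level} (em : ExcludedMiddle (suc ℓ)) {PROP : Set}
  (𝒳 : TopSubsetModel PROP ℓ) where

  open TopSubsetModel 𝒳

  private
    variable
      V : Pred X ℓ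
      x : X

  stable : {P : Set ℓ} → ¬ ¬ P → P
  stable ¬¬p = lower (decidable-stable em λ f → ¬¬p (f ∘ lift))

  -- Otherwise `∁ W` would be a closed superset of `A` missing `x`.
  meets : ∀ {a} {A : Pred X a} {W : Pred X ℓ} → V ⊆ cl A → Open W → x ∈ V → x ∈ W → ¬ (∀ {y} → y ∈ A → ¬ y ∈ W)
  meets {W = W} V⊆ o x∈V x∈W disj =
    V⊆ x∈V (∁ W) (Open-resp ((λ w f → f w) , stable) o) disj x∈W

  dense-∩ : ∀ {a} {A A′ C : Pred X a} {W : Pred X ℓ} → Open V →
    V ⊆ cl (int A) → V ⊆ cl (int A′) → A ∩ A′ ⊆ C →
    Open W → x ∈ V → x ∈ W → ¬ (∀ {y} → y ∈ int C → ¬ y ∈ W)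
  dense-∩ oV dA dA′ A∩A′⊆C oW x∈V x∈W disj =
    -- Intersecting with `V` keeps the point found inside `V`, where `dA′` applies next.
    meets dA (Open-∩ oV oW) x∈V (x∈V , x∈W) λ (S , oS , S⊆ , y∈S) (y∈V , y∈W) →
    meets dA′ (Open-∩ oS oW) y∈V (y∈S , y∈W) λ (S′ , oS′ , S′⊆ , z∈S′) (z∈S , z∈W) →
    disj (_ , Open-∩ oS oS′ , (λ (p , q) → A∩A′⊆C (S⊆ p , S′⊆ q)) , (z∈S , z∈S′)) z∈W

  Open⇒dense : ∀ {a} {A : Pred X a} → Open V → V ⊆ A → V ⊆ cl (int A)
  Open⇒dense o V⊆A y∈V C _ ⊆C = ⊆C (_ , o , V⊆A , y∈V)

  truth-reflects : ∀ φ → Reflects (Truth 𝒳 x V φ)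
    (eval (λ p → does (em {Truth 𝒳 x V (atom p)})) (λ ψ → does (em {Truth 𝒳 x V (B ψ)})) φ)
  truth-reflects (atom p) = proof em
  truth-reflects (∼ φ)    = ¬-reflects (truth-reflects φ)
  truth-reflects (φ ∧ ψ)  = truth-reflects φ ×-reflects truth-reflects ψ
  truth-reflects (B φ)    = proof em

  sound : KD45⊢ φ → Valid 𝒳 φ
  sound {φ = φ} (taut t) x V _ _ =
    invert (subst (Reflects (Truth 𝒳 x V φ)) (t _ _) (truth-reflects φ))
  sound (K φ ψ) x V _ o (bφψ , ¬¬bψ) = ¬¬bψ λ (bφ , ¬bψ) → ¬bψ λ y∈V C closed ⊆C →
    -- The open neighbourhood `∁ C` of `y` would miss the interior of the truth set of `ψ`.
    stable λ y∉C → dense-∩ o bφψ bφ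
      (λ ((z∈V , φ⇒ψ) , (_ , t)) → z∈V , decidable-stable em (λ f → φ⇒ψ (t , f)))
      closed y∈V y∉C (λ z∈ z∉ → z∉ (⊆C z∈))
  sound (D φ) x V x∈V o (bφ , ¬¬b∼φ) = ¬¬b∼φ λ b∼φ →
    -- The two truth sets are disjoint, so the intersection fits in the empty set, whose interior is
    -- empty.
    dense-∩ {C = λ _ → Lift _ ⊥} o bφ b∼φ (λ ((_ , t) , (_ , f)) → ⊥-elim (f t)) o x∈V x∈V
      (λ (_ , _ , ⊆∅ , z∈) _ → lower (⊆∅ z∈))
  sound (four φ) x V _ o (bφ , ¬bbφ) = ¬bbφ (Open⇒dense {A = ⟦ 𝒳 ⟧ (B φ) V} o λ y∈V → y∈V , bφ)
  sound (five φ) x V _ o (¬bφ , ¬b¬bφ) = ¬b¬bφ (Open⇒dense {A = ⟦ 𝒳 ⟧ (∼ B φ) V} o λ y∈V → y∈V , ¬bφ)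
  sound (mp p q) x V x∈V o =
    decidable-stable em λ f → sound p x V x∈V o (sound q x V x∈V o , f)
  sound (nec {φ} p) x V _ o = Open⇒dense {A = ⟦ 𝒳 ⟧ φ V} o λ y∈V → y∈V , sound p _ V y∈V o

-- Completeness and the equivalence

complete : ∀ {ℓ : Level} → ExcludedMiddle (suc ℓ) → {φ : Formula PROP} →
  ((𝒳 : TopSubsetModel PROP ℓ) → Valid 𝒳 φ) → KD45⊢ φ
complete {ℓ = ℓ} em {φ} valid = decidable-stable (map′ lower lift em) refute
  where
  open Lindenbaum (map′ lower lift em)

  refute : ¬ ¬ (KD45⊢ φ)
  refute ⊬φ =
    let γ , γ-con , γ⇒∼φ , γ-dec = extend (closure φ) (∼ φ) (⊬φ ∘ mp ∼∼-elim)
        θ , γ⇒Bθ , θ⇒ = beliefs (closure φ) γ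
        open Canonical {ℓ} em (closure φ) γ γ-con γ-dec θ γ⇒Bθ θ⇒
    -- At the point of `γ`, a proof of `φ` contradicts `γ ⇒ ∼ φ`, and falsity of `φ` contradicts
    -- validity.
    in [ (λ (_ , γ⇒φ) → clash nothing γ⇒φ γ⇒∼φ) , (λ (f , _) → f (valid model _ _ _ (lift _))) ]′
       (settled nothing φ (λ χ∈ → χ∈))

theorem7 : ∀ {ℓ : Level} → ExcludedMiddle (suc ℓ) →
    (PROP : Set) → PROP ↣ ℕ → (φ : Formula PROP) →
    (KD45⊢ φ) ⇔ ((𝒳 : TopSubsetModel PROP ℓ) → Valid 𝒳 φ)
theorem7 em PROP _ φ = mk⇔ (λ ⊢φ 𝒳 → Soundness.sound em 𝒳 ⊢φ) (complete em)
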